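{- Let $n\ge 1$ and let $P$ be the $n\times n$ permutation matrix of a permutation $\sigma\in S_n$. Then $P$ is the leaf matrix of at least one CNM of size $n$ if and only if $\sigma$ is irreducible.
   Context: A complete non-ambiguous matrix (CNM) of size $n$ is an $n\times n$ matrix $M=(m_{i,j})$ with entries in $\{0,1\}$ whose support $T=\{(i,j): m_{i,j}=1\}$ (whose elements are called vertices) satisfies: (1) $(1,1)\in T$; (2) for every $p=(i,j)\in T$ with $p\neq(1,1)$, exactly one of the following holds: there is $(i',j)\in T$ with $i'<i$, or there is $(i,j')\in T$ with $j'<j$; (3) every row and every column of $M$ contains at least one vertex; (4) define the parent of $p=(i,j)\neq(1,1)$ to be $(i',j)$ with $i'<i$ maximal if such a vertex exists, and otherwise $(i,j')$ with $j'<j$ maximal; then every vertex is the parent of either zero or exactly two vertices. A vertex with no children is a leaf. The leaf matrix $p(M)$ is obtained from $M$ by replacing all non-leaf vertices by $0$ (it is a permutation matrix). A permutation $\sigma\in S_n$ is irreducible if there is no $j$ with $1\le j<n$ such that $\sigma(\{1,\dots,j\})=\{1,\dots,j\}$; the permutation matrix of $\sigma$ has its $1$'s at positions $(i,\sigma(i))$. -}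

module Defs where

open import Data.Bool using (Bool; true; false; if_then_else_)
import Data.Bool.Properties as Bool
open import Data.Fin using (Fin; zero; toℕ; _<_; _≤_)
import Data.Fin.Properties as Fin
open import Data.Fin.Permutation using (Permutation′; _⟨$⟩ʳ_)
import Data.Nat as ℕ
open import Data.Nat using (ℕ; suc)
open import Data.Product using (_×_; _,_; proj₁; proj₂; ∃-syntax; ∃₂; uncurry; curry)
import Data.Product.Properties as Product
open import Data.Sum using (_⊎_)
open import Data.Vec.Functional using (Vector)
open import Relation.Binary.PropositionalEquality using (_≡_; _≢_)
open import Relation.Nullary using (¬_; Dec; does)
open import Relation.Nullary.Decidable using (map′; _×-dec_; _⊎-dec_; _→-dec_; ¬?)
open import Relation.Unary using (Pred; Decidable; _≐_)
open import Level using (0ℓ)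

private
  variable
    n : ℕ

-- 0/1 matrices, with true for 1 and false for 0.
Matrix : ℕ → Set
Matrix n = Vector (Vector Bool n) n

-- Since vectors are functions, matrices are compared entrywise.
infix 4 _≗ₘ_
_≗ₘ_ : Matrix n → Matrix n → Set
A ≗ₘ B = ∀ i j → A i j ≡ B i j

-- Positions are (row , column), counted from 0 at the top left.
Position : ℕ → Set
Position n = Fin n × Fin n

row col : Position n → Fin n
row = proj₁
col = proj₂

origin : Position (suc n)
origin = zero , zero

_≟ₚ_ : (p q : Position n) → Dec (p ≡ q)
_≟ₚ_ = Product.≡-dec Fin._≟_ Fin._≟_

allPositions? : {P : Pred (Position n) 0ℓ} → Decidable P → Dec (∀ p → P p)
allPositions? P? =
  map′ uncurry curry (Fin.all? λ i → Fin.all? λ j → P? (i , j))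

None : Pred (Position n) 0ℓ → Set
None P = ∀ p → ¬ P p

ExactlyTwo : Pred (Position n) 0ℓ → Set
ExactlyTwo P = ∃₂ λ a b → a ≢ b × P a × P b × (∀ c → P c → c ≡ a ⊎ c ≡ b)

ExactlyOneOf : Set → Set → Set
ExactlyOneOf A B = (A ⊎ B) × ¬ (A × B)

module _ (M : Matrix (suc n)) where

  Vertex : Pred (Position (suc n)) 0ℓ
  Vertex p = M (row p) (col p) ≡ true

  Above LeftOf : (q p : Position (suc n)) → Set
  Above  q p = Vertex q × col q ≡ col p × row q < row p
  LeftOf q p = Vertex q × row q ≡ row p × col q < col p

  NearestAbove NearestLeft : (q p : Position (suc n)) → Set
  NearestAbove q p = Above  q p × (∀ r → Above  r p → row r ≤ row q)
  NearestLeft  q p = LeftOf q p × (∀ r → LeftOf r p → col r ≤ col q)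

  -- IsParent q p : q is the parent of the vertex p.
  IsParent : (q p : Position (suc n)) → Set
  IsParent q p = Vertex p × p ≢ origin ×
    (NearestAbove q p ⊎ (None (λ r → Above r p) × NearestLeft q p))

  Childless : Pred (Position (suc n)) 0ℓ
  Childless p = None (λ c → IsParent p c)

  Leaf : Pred (Position (suc n)) 0ℓ
  Leaf p = Vertex p × Childless p

  record IsCNM : Set where
    field
      root      : Vertex origin
      exclusive : ∀ p → Vertex p → p ≢ origin →
                  ExactlyOneOf (∃[ q ] Above q p) (∃[ q ] LeftOf q p)
      rows      : ∀ i → ∃[ j ] Vertex (i , j)
      columns   : ∀ j → ∃[ i ] Vertex (i , j)
      complete  : ∀ p → Vertex p →
                  Childless p ⊎ ExactlyTwo (λ c → IsParent p c)

  vertex? : Decidable Vertex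
  vertex? p = M (row p) (col p) Bool.≟ true

  above? : ∀ q p → Dec (Above q p)
  above? q p = vertex? q ×-dec col q Fin.≟ col p ×-dec row q Fin.<? row p

  leftOf? : ∀ q p → Dec (LeftOf q p)
  leftOf? q p = vertex? q ×-dec row q Fin.≟ row p ×-dec col q Fin.<? col p

  nearestAbove? : ∀ q p → Dec (NearestAbove q p)
  nearestAbove? q p = above? q p ×-dec
    allPositions? (λ r → above? r p →-dec row r Fin.≤? row q)

  nearestLeft? : ∀ q p → Dec (NearestLeft q p)
  nearestLeft? q p = leftOf? q p ×-dec
    allPositions? (λ r → leftOf? r p →-dec col r Fin.≤? col q)

  isParent? : ∀ q p → Dec (IsParent q p)
  isParent? q p = vertex? p ×-dec ¬? (p ≟ₚ origin) ×-dec
    (nearestAbove? q p ⊎-dec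
      (allPositions? (λ r → ¬? (above? r p)) ×-dec nearestLeft? q p))

  leaf? : Decidable Leaf
  leaf? p = vertex? p ×-dec allPositions? (λ c → ¬? (isParent? p c))

  leafMatrix : Matrix (suc n)
  leafMatrix i j = if does (leaf? (i , j)) then M i j else false

permutationMatrix : Permutation′ n → Matrix n
permutationMatrix σ i j = does (σ ⟨$⟩ʳ i Fin.≟ j)

-- The set {1,…,j}; with indices counted from 0 these are the k with k < j.
Initial : ℕ → Pred (Fin n) 0ℓ
Initial j k = toℕ k ℕ.< j

Image : {A B : Set} → (A → B) → Pred A 0ℓ → Pred B 0ℓ
Image f P b = ∃[ a ] P a × f a ≡ b

Irreducible : Permutation′ n → Set
Irreducible {n} σ = ∀ j → 1 ℕ.≤ j → j ℕ.< n →
  ¬ (Image (σ ⟨$⟩ʳ_) (Initial j) ≐ Initial j)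

{-# OPTIONS --safe #-}
-- A vertex has a child below (to the right) iff it has a vertex below (to the
-- right), so the last vertex of every row and of every column is a leaf.
--
-- If σ preserved {1,…,j}, all vertices would lie in two diagonal blocks, and a
-- vertex of the second block could be moved up or left inside it forever.
--
-- If σ is irreducible, put f(i) = min { σ(k) : k ≥ i }.  Let g(j) be the first
-- row i with σ(i) ≥ j when j is a right-to-left minimum of σ, and σ⁻¹(j)
-- otherwise.  The CNM has its vertices at the (i , f(i)) and the (g(j) , j):
-- these are the first vertices of the rows and of the columns.  Each vertex
-- other than the origin has exactly one kind of predecessor because
-- g(f(i)) < i and f(g(j)) < j, and a failure of these inequalities would
-- exhibit an initial segment preserved by σ.
module Submission where

open import Defs
open import Data.Nat using (ℕ; suc)
open import Data.Fin.Permutation using (Permutation′)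
open import Data.Product using (_×_; ∃-syntax)
open import Function.Bundles using (_⇔_)

open import Data.Bool using (Bool; true; false; if_then_else_)
open import Data.Empty using (⊥)
open import Data.Fin using (Fin; zero; suc; toℕ; fromℕ<; inject≤; _<_; _≤_; _>_; _≟_; _<?_; _≤?_)
open import Data.Fin.Induction using (<-wellFounded; >-wellFounded)
open import Data.Fin.Permutation using (_⟨$⟩ʳ_; _⟨$⟩ˡ_; flip; inverseˡ; inverseʳ)
import Data.Fin.Properties as Fin
open import Data.Nat using (z≤n; s≤s)
import Data.Nat as ℕ
import Data.Nat.Properties as ℕ
open import Data.Product using (_,_; proj₁; proj₂; -,_)
open import Data.Sum using (_⊎_; inj₁; inj₂)
open import Function using (_∘_)
open import Function.Bundles using (mk⇔)
open import Induction.WellFounded using (Acc; acc)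
open import Level using (0ℓ)
open import Relation.Binary.PropositionalEquality
  using (_≡_; _≢_; refl; sym; trans; cong; subst)
open import Relation.Binary.Definitions using (tri<; tri≈; tri>)
open import Relation.Nullary using (¬_; Dec; yes; no; does; contradiction)
open import Relation.Nullary.Decidable using (dec-true; does-⇔; _×-dec_; _⊎-dec_)
open import Relation.Unary using (Pred; Decidable)

-- Decidability and least elements.

does-true⇒ : {A : Set} (a? : Dec A) → does a? ≡ true → A
does-true⇒ (yes a) _ = a

if-does : {A : Set} (a? : Dec A) {b : Bool} → (A → b ≡ true) →
          (if does a? then b else false) ≡ does a?
if-does (yes a) b≡true = b≡true a
if-does (no _)  _      = refl

least : ∀ {n} {P : Pred (Fin n) 0ℓ} → Decidable P → ∃[ i ] P i →
        ∃[ i ] P i × (∀ j → P j → i ≤ j)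
least {suc n} P? (k , Pk) with P? zero
... | yes P0 = zero , P0 , λ _ _ → z≤n
least {suc n} P? (zero  , Pk) | no ¬P0 = contradiction Pk ¬P0
least {suc n} P? (suc k , Pk) | no ¬P0 with least (P? ∘ suc) (k , Pk)
... | i , Pi , min = suc i , Pi ,
  λ { zero P0 → contradiction P0 ¬P0 ; (suc j) Pj → s≤s (min j Pj) }

-- Children in an arbitrary matrix.

module _ {n : ℕ} (M : Matrix (suc n)) where

  leafMatrix≡does : ∀ i j → leafMatrix M i j ≡ does (leaf? M (i , j))
  leafMatrix≡does i j = if-does (leaf? M (i , j)) proj₁

  parent⇒before : ∀ {p c} → IsParent M p c → Above M p c ⊎ LeftOf M p c
  parent⇒before (_ , _ , inj₁ (above , _))    = inj₁ above
  parent⇒before (_ , _ , inj₂ (_ , left , _)) = inj₂ left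

  -- Of two different vertices below `p` in its column, the upper one lies between `p` and the lower
  -- one, so `p` is not nearest to the lower.
  nearestAbove-unique : ∀ {p c d} → Vertex M c → Vertex M d →
    NearestAbove M p c → NearestAbove M p d → c ≡ d
  nearestAbove-unique {p} {c} {d} vc vd ((_ , refl , p<c) , maxc) ((_ , refl , p<d) , maxd)
    with Fin.<-cmp (row c) (row d)
  ... | tri< c<d _ _ = contradiction (maxd c (vc , refl , c<d)) (ℕ.<⇒≱ p<c)
  ... | tri≈ _ refl _ = refl
  ... | tri> _ _ d<c = contradiction (maxc d (vd , refl , d<c)) (ℕ.<⇒≱ p<d)

  nearestLeft-unique : ∀ {p c d} → Vertex M c → Vertex M d →
    NearestLeft M p c → NearestLeft M p d → c ≡ d
  nearestLeft-unique {p} {c} {d} vc vd ((_ , refl , p<c) , maxc) ((_ , refl , p<d) , maxd)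
    with Fin.<-cmp (col c) (col d)
  ... | tri< c<d _ _ = contradiction (maxd c (vc , refl , c<d)) (ℕ.<⇒≱ p<c)
  ... | tri≈ _ refl _ = refl
  ... | tri> _ _ d<c = contradiction (maxc d (vd , refl , d<c)) (ℕ.<⇒≱ p<d)

  -- By uniqueness a vertex has at most one child in its column and one in its row, so two children
  -- must be one of each kind.
  twoChildren⇒below×right : ∀ {p} → ExactlyTwo (λ c → IsParent M p c) →
    (∃[ q ] Vertex M q × Above M p q) × (∃[ q ] Vertex M q × LeftOf M p q)
  twoChildren⇒below×right (a , b , a≢b , (va , _ , inj₁ up) , (vb , _ , inj₁ up′) , _) =
    contradiction (nearestAbove-unique va vb up up′) a≢b
  twoChildren⇒below×right (a , b , a≢b , (va , _ , inj₁ (up , _)) , (vb , _ , inj₂ (_ , left , _)) , _) =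
    (a , va , up) , (b , vb , left)
  twoChildren⇒below×right (a , b , a≢b , (va , _ , inj₂ (_ , left , _)) , (vb , _ , inj₁ (up , _)) , _) =
    (b , vb , up) , (a , va , left)
  twoChildren⇒below×right (a , b , a≢b , (va , _ , inj₂ (_ , left)) , (vb , _ , inj₂ (_ , left′)) , _) =
    contradiction (nearestLeft-unique va vb left left′) a≢b

  nextBelow : ∀ {p q} → Vertex M q → Above M p q →
    ∃[ c ] Vertex M c × NearestAbove M p c
  nextBelow {i , j} {k , _} vq (vp , refl , i<k)
    with least (λ k → i <? k ×-dec vertex? M (k , j)) (k , i<k , vq)
  ... | m , (i<m , vm) , min = (m , j) , vm , (vp , refl , i<m) ,
    λ { (r , _) (vr , refl , r<m) →
        ℕ.≮⇒≥ λ i<r → contradiction (min r (i<r , vr)) (ℕ.<⇒≱ r<m) }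

  nextRight : ∀ {p q} → Vertex M q → LeftOf M p q →
    ∃[ c ] Vertex M c × NearestLeft M p c
  nextRight {i , j} {_ , k} vq (vp , refl , j<k)
    with least (λ k → j <? k ×-dec vertex? M (i , k)) (k , j<k , vq)
  ... | m , (j<m , vm) , min = (i , m) , vm , (vp , refl , j<m) ,
    λ { (_ , r) (vr , refl , r<m) →
        ℕ.≮⇒≥ λ j<r → contradiction (min r (j<r , vr)) (ℕ.<⇒≱ r<m) }

  -- The children are the next vertex below and the next one to the right. For the latter to count
  -- `p` as its parent, nothing may lie above it; since `p` is to its left, this follows from the
  -- exclusivity hypothesis.
  below×right⇒twoChildren :
    (∀ p → Vertex M p → p ≢ origin → ¬ ((∃[ q ] Above M q p) × (∃[ q ] LeftOf M q p))) →
    ∀ {p q r} → Vertex M q → Above M p q → Vertex M r → LeftOf M p r →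
    ExactlyTwo (λ c → IsParent M p c)
  below×right⇒twoChildren notBoth {p} vq p↑q vr p←r
    with nextBelow vq p↑q | nextRight vr p←r
  ... | a , va , near↑@((_ , refl , p<a) , _) | b , vb , near←@(p←b@(_ , refl , p<b) , _) =
    a , b , a≢b , (va , a≢origin , inj₁ near↑) , (vb , b≢origin , inj₂ (noneAbove , near←)) , only
    where
    a≢b : a ≢ b
    a≢b a≡b = ℕ.<-irrefl (cong (toℕ ∘ row) (sym a≡b)) p<a
    a≢origin : a ≢ origin
    a≢origin refl = ℕ.n≮0 p<a
    b≢origin : b ≢ origin
    b≢origin refl = ℕ.n≮0 p<b
    noneAbove : None (λ s → Above M s b)
    noneAbove s s↑b = notBoth b vb b≢origin ((s , s↑b) , (p , p←b))
    only : ∀ c → IsParent M p c → c ≡ a ⊎ c ≡ b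
    only c (vc , _ , inj₁ near)       = inj₁ (nearestAbove-unique vc va near near↑)
    only c (vc , _ , inj₂ (_ , near)) = inj₂ (nearestLeft-unique vc vb near near←)

-- Leaf matrices come from irreducible permutations.

module _ {n : ℕ} (σ : Permutation′ (suc n)) {M : Matrix (suc n)} (cnm : IsCNM M)
         (leaves : leafMatrix M ≗ₘ permutationMatrix σ) where
  open IsCNM cnm

  leaf⇒σ : ∀ {i j} → Leaf M (i , j) → σ ⟨$⟩ʳ i ≡ j
  leaf⇒σ {i} {j} leaf = does-true⇒ (σ ⟨$⟩ʳ i ≟ j)
    (trans (sym (leaves i j)) (trans (leafMatrix≡does M i j) (dec-true (leaf? M (i , j)) leaf)))

  -- A vertex that is not a leaf has another vertex to its right, so moving right along row `i` ends
  -- at a leaf, which is at column σ(i).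
  vertex⇒col≤σ : ∀ {i j} → Vertex M (i , j) → Acc _>_ j → j ≤ σ ⟨$⟩ʳ i
  vertex⇒col≤σ {i} {j} v (acc rec) with complete (i , j) v
  ... | inj₁ childless = ℕ.≤-reflexive (cong toℕ (sym (leaf⇒σ (v , childless))))
  ... | inj₂ two with twoChildren⇒below×right M two
  ...   | _ , ((_ , k) , vq , _ , refl , j<k) =
    ℕ.≤-trans (ℕ.<⇒≤ j<k) (vertex⇒col≤σ vq (rec j<k))

  vertex⇒row≤σ⁻¹ : ∀ {i j} → Vertex M (i , j) → Acc _>_ i → i ≤ σ ⟨$⟩ˡ j
  vertex⇒row≤σ⁻¹ {i} {j} v (acc rec) with complete (i , j) v
  ... | inj₁ childless = ℕ.≤-reflexive (cong toℕ
    (trans (sym (inverseˡ σ)) (cong (σ ⟨$⟩ˡ_) (leaf⇒σ (v , childless)))))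
  ... | inj₂ two with twoChildren⇒below×right M two
  ...   | ((k , _) , vq , _ , refl , i<k) , _ =
    ℕ.≤-trans (ℕ.<⇒≤ i<k) (vertex⇒row≤σ⁻¹ vq (rec i<k))

  leafMatrix⇒irreducible : Irreducible σ
  leafMatrix⇒irreducible j 1≤j j<n (image⊆ , ⊆image) =
    -- Counted from 0, row `j` is the first one outside the invariant segment.
    empty (proj₂ (rows start)) (ℕ.≤-reflexive (sym (Fin.toℕ-fromℕ< j<n)))
      (<-wellFounded _) (<-wellFounded _)
    where
    start : Fin (suc n)
    start = fromℕ< j<n

    σ-initial : ∀ {k} → toℕ k ℕ.< j → toℕ (σ ⟨$⟩ʳ k) ℕ.< j
    σ-initial k<j = image⊆ (-, k<j , refl)

    σ⁻¹-initial : ∀ {k} → toℕ k ℕ.< j → toℕ (σ ⟨$⟩ˡ k) ℕ.< j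
    σ⁻¹-initial k<j with ⊆image k<j
    ... | a , a<j , refl = subst (λ x → toℕ x ℕ.< j) (sym (inverseˡ σ)) a<j

    -- If c < j, then r ≤ σ⁻¹(c) < j.
    row⇒col : ∀ {r c} → Vertex M (r , c) → j ℕ.≤ toℕ r → j ℕ.≤ toℕ c
    row⇒col v j≤r = ℕ.≮⇒≥ λ c<j →
      ℕ.<⇒≱ (σ⁻¹-initial c<j) (ℕ.≤-trans j≤r (vertex⇒row≤σ⁻¹ v (>-wellFounded _)))

    col⇒row : ∀ {r c} → Vertex M (r , c) → j ℕ.≤ toℕ c → j ℕ.≤ toℕ r
    col⇒row v j≤c = ℕ.≮⇒≥ λ r<j →
      ℕ.<⇒≱ (σ-initial r<j) (ℕ.≤-trans j≤c (vertex⇒col≤σ v (>-wellFounded _)))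

    empty : ∀ {r c} → Vertex M (r , c) → j ℕ.≤ toℕ r → Acc _<_ r → Acc _<_ c → ⊥
    empty {r} {c} v j≤r accr@(acc recr) accc@(acc recc)
      -- The vertex is not the origin because 1 ≤ j ≤ r. A move up keeps the column, which is at
      -- least `j`, so the new row is still at least `j`; a move left keeps the row.
      with proj₁ (exclusive (r , c) v λ { refl → ℕ.<⇒≱ 1≤j j≤r })
    ... | inj₁ ((r′ , _) , vq , refl , r′<r) =
      empty vq (col⇒row vq (row⇒col v j≤r)) (recr r′<r) accc
    ... | inj₂ ((_ , c′) , vq , refl , c′<c) = empty vq j≤r accr (recc c′<c)

-- First positions at which a permutation reaches a value.

module _ {n : ℕ} (σ : Permutation′ n) where

  firstReaching : ∀ v → ∃[ i ] v ≤ σ ⟨$⟩ʳ i × (∀ k → v ≤ σ ⟨$⟩ʳ k → i ≤ k)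
  firstReaching v = least (λ i → v ≤? σ ⟨$⟩ʳ i)
    (σ ⟨$⟩ˡ v , ℕ.≤-reflexive (cong toℕ (sym (inverseʳ σ))))

  -- Applied to `flip σ` and a row i, this is the least v with σ⁻¹(v) ≥ i, that is, min { σ(k) : k ≥
  -- i }.
  reach : Fin n → Fin n
  reach v = proj₁ (firstReaching v)

  ≤-σ-reach : ∀ v → v ≤ σ ⟨$⟩ʳ reach v
  ≤-σ-reach v = proj₁ (proj₂ (firstReaching v))

  reach-least : ∀ {v k} → v ≤ σ ⟨$⟩ʳ k → reach v ≤ k
  reach-least = proj₂ (proj₂ (firstReaching _)) _

  reach≤σ⁻¹ : ∀ v → reach v ≤ σ ⟨$⟩ˡ v
  reach≤σ⁻¹ v = reach-least (ℕ.≤-reflexive (cong toℕ (sym (inverseʳ σ))))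

  -- Pigeonhole principle: σ restricts to an injection from an `a`-element set into a `b`-element
  -- set.
  initial-≤ : ∀ {a b} → a ℕ.≤ n → (∀ {k} → toℕ k ℕ.< a → toℕ (σ ⟨$⟩ʳ k) ℕ.< b) → a ℕ.≤ b
  initial-≤ {a} {b} a≤n bound = Fin.injective⇒≤ {f = restriction} injective
    where
    bounded : ∀ x → toℕ (σ ⟨$⟩ʳ inject≤ x a≤n) ℕ.< b
    bounded x = bound (subst (ℕ._< a) (sym (Fin.toℕ-inject≤ x a≤n)) (Fin.toℕ<n x))
    restriction : Fin a → Fin b
    restriction x = fromℕ< (bounded x)
    injective : ∀ {x y} → restriction x ≡ restriction y → x ≡ y
    injective {x} {y} eq = Fin.inject≤-injective a≤n a≤n x y
      (trans (sym (inverseˡ σ)) (trans (cong (σ ⟨$⟩ˡ_)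
        (Fin.toℕ-injective (Fin.fromℕ<-injective _ _ (bounded x) (bounded y) eq))) (inverseˡ σ)))

reach-zero : ∀ {n} (σ : Permutation′ (suc n)) → reach σ zero ≡ zero
reach-zero σ = Fin.toℕ-injective (ℕ.n≤0⇒n≡0 (reach-least σ {k = zero} z≤n))

irreducible-flip : ∀ {n} (σ : Permutation′ n) → Irreducible σ → Irreducible (flip σ)
irreducible-flip σ irr j 1≤j j<n (image⊆ , ⊆image) = irr j 1≤j j<n (⊆₁ , ⊆₂)
  where
  ⊆₁ : ∀ {k} → Image (σ ⟨$⟩ʳ_) (Initial j) k → Initial j k
  ⊆₁ (a , a<j , refl) with ⊆image a<j
  ... | b , b<j , refl = subst (Initial j) (sym (inverseʳ σ)) b<j
  ⊆₂ : ∀ {k} → Initial j k → Image (σ ⟨$⟩ʳ_) (Initial j) k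
  ⊆₂ {k} k<j = σ ⟨$⟩ˡ k , image⊆ (k , k<j , refl) , inverseʳ σ

-- With v = min { σ(k) : k ≥ i }, a first row ≥ i reaching v would mean that
-- k < i exactly when σ(k) < v, so that i = v and σ preserves {k : k < i}.
reach-reach< : ∀ {n} (σ : Permutation′ (suc n)) → Irreducible σ →
  ∀ {i} → i ≢ zero → reach σ (reach (flip σ) i) < i
reach-reach< {n} σ irr {i} i≢0 = ℕ.≰⇒> λ i≤reach →
  let
    v = reach (flip σ) i
    below : ∀ {k} → k < i → σ ⟨$⟩ʳ k < v
    below k<i = ℕ.≰⇒> λ v≤σk → ℕ.<⇒≱ k<i (ℕ.≤-trans i≤reach (reach-least σ v≤σk))
    below⁻¹ : ∀ {w} → w < v → σ ⟨$⟩ˡ w < i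
    below⁻¹ w<v = ℕ.≰⇒> λ i≤σ⁻¹w → ℕ.<⇒≱ w<v (reach-least (flip σ) i≤σ⁻¹w)
    i≡v : toℕ i ≡ toℕ v
    i≡v = ℕ.≤-antisym (initial-≤ σ (ℕ.<⇒≤ (Fin.toℕ<n i)) below)
                      (initial-≤ (flip σ) (ℕ.<⇒≤ (Fin.toℕ<n v)) below⁻¹)
  in irr (toℕ i) (ℕ.n≢0⇒n>0 (i≢0 ∘ Fin.toℕ-injective)) (Fin.toℕ<n i)
       ( (λ { (k , k<i , refl) → subst (toℕ (σ ⟨$⟩ʳ k) ℕ.<_) (sym i≡v) (below k<i) })
       , (λ {w} w<i → σ ⟨$⟩ˡ w , below⁻¹ (subst (toℕ w ℕ.<_) i≡v w<i) , inverseʳ σ))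

-- The matrix with prescribed first vertices of rows and columns.

module _ {n : ℕ} (f g : Fin (suc n) → Fin (suc n)) where

  vertexAt? : ∀ i j → Dec (f i ≡ j ⊎ g j ≡ i)
  vertexAt? i j = f i ≟ j ⊎-dec g j ≟ i

  firstsMatrix : Matrix (suc n)
  firstsMatrix i j = does (vertexAt? i j)

  ⇒vertex : ∀ {i j} → f i ≡ j ⊎ g j ≡ i → Vertex firstsMatrix (i , j)
  ⇒vertex {i} {j} = dec-true (vertexAt? i j)

  vertex⇒ : ∀ {i j} → Vertex firstsMatrix (i , j) → f i ≡ j ⊎ g j ≡ i
  vertex⇒ {i} {j} = does-true⇒ (vertexAt? i j)

  module _ (f0 : f zero ≡ zero) (g0 : g zero ≡ zero)
           (gf< : ∀ {i} → i ≢ zero → g (f i) < i) (fg< : ∀ {j} → j ≢ zero → f (g j) < j) where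

    -- A vertex off the graph of `f` is some (g(j) , j), and by `fg<` the vertex (g(j) , f(g(j)))
    -- lies to its left. The exception j = 0 is the origin.
    f≤col : ∀ {i j} → Vertex firstsMatrix (i , j) → f i ≤ j
    f≤col {i} {j} v with vertex⇒ v
    ... | inj₁ refl = ℕ.≤-refl
    ... | inj₂ refl with j ≟ zero
    ...   | yes refl = ℕ.≤-reflexive (cong toℕ (trans (cong f g0) f0))
    ...   | no j≢0   = ℕ.<⇒≤ (fg< j≢0)

    g≤row : ∀ {i j} → Vertex firstsMatrix (i , j) → g j ≤ i
    g≤row {i} {j} v with vertex⇒ v
    ... | inj₂ refl = ℕ.≤-refl
    ... | inj₁ refl with i ≟ zero
    ...   | yes refl = ℕ.≤-reflexive (cong toℕ (trans (cong g f0) g0))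
    ...   | no i≢0   = ℕ.<⇒≤ (gf< i≢0)

    firsts-exclusive : ∀ p → Vertex firstsMatrix p → p ≢ origin →
      ExactlyOneOf (∃[ q ] Above firstsMatrix q p) (∃[ q ] LeftOf firstsMatrix q p)
    firsts-exclusive (i , j) v p≢origin with vertex⇒ v
    -- This vertex is the first of its row, so nothing is to its left, and the first vertex of its
    -- column is strictly higher.
    ... | inj₁ refl = inj₁ ((g (f i) , f i) , ⇒vertex (inj₂ refl) , refl , gf< i≢0) ,
      λ { (_ , (_ , k) , vq , refl , k<j) → ℕ.<⇒≱ k<j (f≤col vq) }
      where
      i≢0 : i ≢ zero
      i≢0 refl = p≢origin (cong (zero ,_) f0)
    ... | inj₂ refl = inj₂ ((g j , f (g j)) , ⇒vertex (inj₁ refl) , refl , fg< j≢0) ,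
      λ { (((k , _) , vq , refl , k<i) , _) → ℕ.<⇒≱ k<i (g≤row vq) }
      where
      j≢0 : j ≢ zero
      j≢0 refl = p≢origin (cong (_, zero) g0)

    module _ (σ : Permutation′ (suc n))
             (onGraph : ∀ i → Vertex firstsMatrix (i , σ ⟨$⟩ʳ i))
             (col≤ : ∀ {i j} → Vertex firstsMatrix (i , j) → j ≤ σ ⟨$⟩ʳ i)
             (row≤ : ∀ {i j} → Vertex firstsMatrix (i , j) → i ≤ σ ⟨$⟩ˡ j) where

      -- By `col≤` and `row≤` this position is the last vertex of its row and of its column, whereas
      -- a child would lie further right or further down.
      graph-childless : ∀ i → Childless firstsMatrix (i , σ ⟨$⟩ʳ i)
      graph-childless i c par@(vc , _) with parent⇒before firstsMatrix par
      ... | inj₁ (_ , refl , i<c) = ℕ.<⇒≱ i<c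
        (subst (row c ≤_) (inverseˡ σ) (row≤ vc))
      ... | inj₂ (_ , refl , σi<c) = ℕ.<⇒≱ σi<c (col≤ vc)

      -- The graph of σ supplies a vertex to the right, in column σ(i), and one below, in row
      -- σ⁻¹(j).
      nonGraph-twoChildren : ∀ {i j} → Vertex firstsMatrix (i , j) → σ ⟨$⟩ʳ i ≢ j →
        ExactlyTwo (λ c → IsParent firstsMatrix (i , j) c)
      nonGraph-twoChildren {i} {j} v σi≢j =
        below×right⇒twoChildren firstsMatrix (λ p vp p≢o → proj₂ (firsts-exclusive p vp p≢o))
          graph-j (v , refl , Fin.≤∧≢⇒< (row≤ v) λ { refl → σi≢j (inverseʳ σ) })
          (onGraph i) (v , refl , Fin.≤∧≢⇒< (col≤ v) (σi≢j ∘ sym))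
        where
        graph-j : Vertex firstsMatrix (σ ⟨$⟩ˡ j , j)
        graph-j = subst (λ k → Vertex firstsMatrix (σ ⟨$⟩ˡ j , k)) (inverseʳ σ) (onGraph _)

      firsts-complete : ∀ p → Vertex firstsMatrix p →
        Childless firstsMatrix p ⊎ ExactlyTwo (λ c → IsParent firstsMatrix p c)
      firsts-complete (i , j) v with σ ⟨$⟩ʳ i ≟ j
      ... | yes refl = inj₁ (graph-childless i)
      ... | no σi≢j  = inj₂ (nonGraph-twoChildren v σi≢j)

      firsts-isCNM : IsCNM firstsMatrix
      firsts-isCNM = record
        { root      = ⇒vertex (inj₁ f0)
        ; exclusive = firsts-exclusive
        ; rows      = λ i → f i , ⇒vertex (inj₁ refl)
        ; columns   = λ j → g j , ⇒vertex (inj₂ refl)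
        ; complete  = firsts-complete
        }

      leaf⇔graph : ∀ i j → Leaf firstsMatrix (i , j) ⇔ σ ⟨$⟩ʳ i ≡ j
      leaf⇔graph i j = mk⇔ to λ { refl → onGraph i , graph-childless i }
        where
        to : Leaf firstsMatrix (i , j) → σ ⟨$⟩ʳ i ≡ j
        to (v , childless) with σ ⟨$⟩ʳ i ≟ j
        ... | yes σi≡j = σi≡j
        ... | no σi≢j with nonGraph-twoChildren v σi≢j
        ...   | a , _ , _ , par , _ = contradiction par (childless a)

      firsts-leafMatrix : leafMatrix firstsMatrix ≗ₘ permutationMatrix σ
      firsts-leafMatrix i j = trans (leafMatrix≡does firstsMatrix i j)
        (does-⇔ (leaf⇔graph i j) (leaf? firstsMatrix (i , j)) (σ ⟨$⟩ʳ i ≟ j))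

-- The first vertices for an irreducible permutation.

module _ {n : ℕ} (σ : Permutation′ (suc n)) where

  firstInRow : Fin (suc n) → Fin (suc n)
  firstInRow = reach (flip σ)

  -- The minimum of σ over the rows from σ⁻¹(j) on is attained at σ⁻¹(j) itself.
  IsRightToLeftMinimum : Pred (Fin (suc n)) 0ℓ
  IsRightToLeftMinimum j = firstInRow (σ ⟨$⟩ˡ j) ≡ j

  -- The position (σ⁻¹(j) , j) has to be a vertex. For a right-to-left minimum it already starts its
  -- row, which leaves column `j` free to start elsewhere; otherwise it must start its column.
  firstInColumn : Fin (suc n) → Fin (suc n)
  firstInColumn j with firstInRow (σ ⟨$⟩ˡ j) ≟ j
  ... | yes _ = reach σ j
  ... | no  _ = σ ⟨$⟩ˡ j

  firstInColumn-minimum : ∀ {j} → IsRightToLeftMinimum j → firstInColumn j ≡ reach σ j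
  firstInColumn-minimum {j} min with firstInRow (σ ⟨$⟩ˡ j) ≟ j
  ... | yes _   = refl
  ... | no ¬min = contradiction min ¬min

  zero-minimum : IsRightToLeftMinimum zero
  zero-minimum = Fin.toℕ-injective (ℕ.n≤0⇒n≡0 (reach-least (flip σ) ℕ.≤-refl))

  -- The value v = min { σ(k) : k ≥ i } is attained at the row σ⁻¹(v) ≥ i, and a minimum over the
  -- fewer rows from σ⁻¹(v) on cannot be smaller.
  firstInRow-minimum : ∀ i → IsRightToLeftMinimum (firstInRow i)
  firstInRow-minimum i = Fin.toℕ-injective (ℕ.≤-antisym
    (reach-least (flip σ) ℕ.≤-refl)
    (reach-least (flip σ) (ℕ.≤-trans (≤-σ-reach (flip σ) i) (≤-σ-reach (flip σ) _))))

  column∘row< : Irreducible σ → ∀ {i} → i ≢ zero → firstInColumn (firstInRow i) < i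
  column∘row< irr {i} i≢0 = subst (_< i) (sym (firstInColumn-minimum (firstInRow-minimum i)))
    (reach-reach< σ irr i≢0)

  -- For a right-to-left minimum this is `reach-reach<` for σ⁻¹, which is irreducible too. Otherwise
  -- the row σ⁻¹(j) contributes `j` to its own minimum, and equality is the excluded case.
  row∘column< : Irreducible σ → ∀ {j} → j ≢ zero → firstInRow (firstInColumn j) < j
  row∘column< irr {j} j≢0 with firstInRow (σ ⟨$⟩ˡ j) ≟ j
  ... | yes _   = reach-reach< (flip σ) (irreducible-flip σ irr) j≢0
  ... | no ¬min = Fin.≤∧≢⇒< (reach-least (flip σ) ℕ.≤-refl) ¬min

  ≤-σ-firstInColumn : ∀ j → j ≤ σ ⟨$⟩ʳ firstInColumn j
  ≤-σ-firstInColumn j with firstInRow (σ ⟨$⟩ˡ j) ≟ j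
  ... | yes _ = ≤-σ-reach σ j
  ... | no  _ = ℕ.≤-reflexive (cong toℕ (sym (inverseʳ σ)))

  firstInColumn≤σ⁻¹ : ∀ j → firstInColumn j ≤ σ ⟨$⟩ˡ j
  firstInColumn≤σ⁻¹ j with firstInRow (σ ⟨$⟩ˡ j) ≟ j
  ... | yes _ = reach≤σ⁻¹ σ j
  ... | no  _ = ℕ.≤-refl

  row-or-column : ∀ j → firstInRow (σ ⟨$⟩ˡ j) ≡ j ⊎ firstInColumn j ≡ σ ⟨$⟩ˡ j
  row-or-column j with firstInRow (σ ⟨$⟩ˡ j) ≟ j
  ... | yes min = inj₁ min
  ... | no  _   = inj₂ refl

  irreducible⇒leafMatrix : Irreducible σ → ∃[ M ] (IsCNM M × leafMatrix M ≗ₘ permutationMatrix σ)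
  irreducible⇒leafMatrix irr =
    M , firsts-isCNM f g f0 g0 (column∘row< irr) (row∘column< irr) σ onGraph col≤ row≤
      , firsts-leafMatrix f g f0 g0 (column∘row< irr) (row∘column< irr) σ onGraph col≤ row≤
    where
    f g : Fin (suc n) → Fin (suc n)
    f = firstInRow
    g = firstInColumn
    M : Matrix (suc n)
    M = firstsMatrix f g
    f0 : f zero ≡ zero
    f0 = reach-zero (flip σ)
    g0 : g zero ≡ zero
    g0 = trans (firstInColumn-minimum zero-minimum) (reach-zero σ)
    onGraph : ∀ i → Vertex M (i , σ ⟨$⟩ʳ i)
    onGraph i = subst (λ k → Vertex M (k , σ ⟨$⟩ʳ i)) (inverseˡ σ)
      (⇒vertex f g (row-or-column (σ ⟨$⟩ʳ i)))
    col≤ : ∀ {i j} → Vertex M (i , j) → j ≤ σ ⟨$⟩ʳ i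
    col≤ {i} {j} v with vertex⇒ f g v
    ... | inj₁ refl = reach≤σ⁻¹ (flip σ) i
    ... | inj₂ refl = ≤-σ-firstInColumn j
    row≤ : ∀ {i j} → Vertex M (i , j) → i ≤ σ ⟨$⟩ˡ j
    row≤ {i} {j} v with vertex⇒ f g v
    ... | inj₁ refl = ≤-σ-reach (flip σ) i
    ... | inj₂ refl = firstInColumn≤σ⁻¹ j

theorem3p1 : ∀ (n : ℕ) (σ : Permutation′ (suc n)) →
    (∃[ M ] (IsCNM M × leafMatrix M ≗ₘ permutationMatrix σ)) ⇔ Irreducible σ
theorem3p1 n σ = mk⇔ (λ (M , cnm , leaves) → leafMatrix⇒irreducible σ cnm leaves)
                     (irreducible⇒leafMatrix σ)
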